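{- Let $\rho$ be a positive integer and $v$ an integer with $v \ge \frac{1}{2}(27\rho^2 - 3\rho + 60)$. Then every $(v,4)$-packing in which the maximum partial parallel class has size $\rho$ has at most \[ \frac{\rho v}{3} - \frac{\rho(\rho+1)}{6} \] blocks.
   Context: For integers $v \ge k \ge 2$, a $(v,k)$-packing is a pair $(X,\mathcal{B})$ where $X$ is a set of $v$ points and $\mathcal{B}$ is a set of $k$-subsets of $X$ (blocks) such that every pair of distinct points lies in at most one block. A partial parallel class (PPC) is a set of pairwise disjoint blocks; its size is the number of blocks. "The maximum PPC has size $\rho$" means the packing has a PPC of size $\rho$ but none of size $\rho+1$. -}

module Defs where

open import Data.Fin using (Fin)
open import Data.Fin.Subset using (Subset; Empty; _∩_; ∣_∣) renaming (_∈_ to _∈ₛ_)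
open import Data.List using (List; length)
open import Data.List.Membership.Propositional using (_∈_)
open import Data.List.Relation.Unary.Unique.Propositional using (Unique)
open import Data.Nat using (ℕ; _≤_; _+_)
open import Data.Product using (∃; _×_)
open import Relation.Binary.PropositionalEquality using (_≡_; _≢_)
open import Relation.Nullary using (¬_)

-- The point set is Fin v.  A finite set of blocks is a duplicate-free list,
-- so that its cardinality is the length of the list.
record Packing (v k : ℕ) : Set where
  field
    2≤k        : 2 ≤ k
    k≤v        : k ≤ v
    blocks     : List (Subset v)
    unique     : Unique blocks
    block-size : ∀ {B} → B ∈ blocks → ∣ B ∣ ≡ k
    pair       : ∀ {x y : Fin v} → x ≢ y →
                 ∀ {A B} → A ∈ blocks → B ∈ blocks →
                 x ∈ₛ A → y ∈ₛ A → x ∈ₛ B → y ∈ₛ B → A ≡ B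

open Packing public

numBlocks : ∀ {v k} → Packing v k → ℕ
numBlocks 𝓟 = length (blocks 𝓟)

-- Partial parallel classes, again as duplicate-free lists.
record IsPPC {v k : ℕ} (𝓟 : Packing v k) (P : List (Subset v)) : Set where
  field
    ppc-unique   : Unique P
    ppc-blocks   : ∀ {B} → B ∈ P → B ∈ blocks 𝓟
    ppc-disjoint : ∀ {A B} → A ∈ P → B ∈ P → A ≢ B → Empty (A ∩ B)

open IsPPC public

HasPPCOfSize : ∀ {v k} → Packing v k → ℕ → Set
HasPPCOfSize 𝓟 n = ∃ λ P → IsPPC 𝓟 P × length P ≡ n

MaxPPCSize : ∀ {v k} → Packing v k → ℕ → Set
MaxPPCSize 𝓟 ρ = HasPPCOfSize 𝓟 ρ × ¬ HasPPCOfSize 𝓟 (ρ + 1)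

{-# OPTIONS --safe #-}

-- Let P be a maximum PPC with ρ blocks.  Call a block tangent at x if x is its only point
-- covered by P, and call x heavy if it has at least 13 tangents.  By maximality a block of P
-- with at least 4 tangents at one point has none at its other points, so it contains at most
-- one heavy point.  Let H be the set of heavy points, h = |H| and m = ρ - h.
--
-- Counting blocks by their last point in H, at most hv/3 - h(h+1)/6 blocks meet H.  A block
-- missing H is a member of P without heavy point (m of them), or tangent at such a member
-- (at most 12 each), or joins non-heavy points of two members of P; as the members have
-- 3 (ρ-m times) or 4 (m times) non-heavy points, there are at most
-- ((3ρ+m)² - 9ρ - 7m)/2 of the last kind.  For m > 0 the bound on v makes the total small enough.
-- For m = 0 all blocks meet H: given a block A missing H, each of the at most four members of
-- P meeting A could be exchanged for a tangent at its heavy point, making room for A.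
module Submission where

open import Defs
open import Data.Nat as ℕ using (ℕ)

module BlockCount where

  open import Data.Empty using (⊥; ⊥-elim)
  import Data.Bool.Properties as Bool
  open import Data.Fin using (Fin; zero; suc)
  import Data.Fin.Properties as Fin
  open import Data.Fin.Subset using (Subset; inside; outside; ∣_∣) renaming (_∈_ to _∈ₛ_; _∉_ to _∉ₛ_)
  open import Data.Fin.Subset.Properties using (_∈?_; x∈p∩q⁺; x∈p∩q⁻)
  open import Data.List using (List; []; _∷_; _++_; length; map; filter; concat; cartesianProduct)
  open import Data.List.Membership.Propositional using (_∈_; _∉_; find; lose)
  open import Data.List.Membership.Propositional.Properties
  open import Data.List.Properties using (length-map; length-++; length-tabulate)
  open import Data.List.Relation.Binary.Permutation.Propositional.Properties using (↭-length; shift; ∈-resp-↭)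
  open import Data.List.Relation.Unary.All as All using (All; []; _∷_)
  import Data.List.Relation.Unary.All.Properties as All
  open import Data.List.Relation.Unary.AllPairs as AllPairs using (AllPairs; []; _∷_)
  import Data.List.Relation.Unary.AllPairs.Properties as AllPairs
  open import Data.List.Relation.Unary.Any as Any using (Any; here; there)
  open import Data.List.Relation.Unary.Unique.Propositional using (Unique)
  import Data.List.Relation.Unary.Unique.Propositional.Properties as Uniq
  open import Data.Nat using (zero; suc; _+_; _*_; _∸_; _/_; _≤_; _<_; _≤?_; z≤n; s≤s)
  open import Data.Nat.DivMod using (m*n/n≡m; m/n*n≤m; /-monoˡ-≤)
  open import Data.Nat.ListAction using (sum)
  open import Data.Nat.Properties hiding (suc-injective)
  open import Data.Nat.Tactic.RingSolver using (solve-∀)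
  open import Data.Product using (∃; ∃₂; _×_; _,_; proj₁; proj₂)
  open import Data.Sum using (_⊎_; inj₁; inj₂; [_,_]′)
  open import Data.Vec as Vec using ([]; _∷_)
  import Data.Vec.Properties as Vec
  open import Function using (_∘_)
  open import Relation.Binary using (DecidableEquality)
  open import Relation.Binary.PropositionalEquality using (_≡_; _≢_; refl; sym; trans; cong; cong₂; subst)
  open import Relation.Nullary using (¬_; yes; no; ¬?; contradiction)
  open import Relation.Nullary.Decidable using (_×-dec_; _→-dec_; decidable-stable)
  open import Relation.Unary using (Decidable)

  -- Counting with duplicate-free lists

  -- Deleting from `K` a key of the head of `L` leaves the keys of all other elements in place,
  -- since a shared key would identify them with the head. `R` is a relation, so an element may have
  -- several keys and none has to be singled out.
  matching-≤ : ∀ {A B : Set} (R : A → B → Set) (L : List A) (K : List B) → Unique L →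
    (∀ {a} → a ∈ L → ∃ λ k → k ∈ K × R a k) →
    (∀ {a b k} → a ∈ L → b ∈ L → R a k → R b k → a ≡ b) →
    length L ≤ length K
  matching-≤ R [] K _ _ _ = z≤n
  matching-≤ R (a ∷ L) K (a∉L ∷ u) key inj with key (here refl)
  ... | k , k∈K , r with ∈-∃++ k∈K
  ... | ys , zs , refl = subst (suc (length L) ≤_) (sym (↭-length (shift k ys zs)))
      (s≤s (matching-≤ R L (ys ++ zs) u key′ (λ i j → inj (there i) (there j))))
    where
    key′ : ∀ {b} → b ∈ L → ∃ λ l → l ∈ ys ++ zs × R b l
    key′ b∈L with key (there b∈L)
    ... | l , l∈K , s with ∈-resp-↭ (shift k ys zs) l∈K
    ... | here refl = contradiction (inj (here refl) (there b∈L) r s) (All.lookup a∉L b∈L)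
    ... | there l∈  = l , l∈ , s

  ⊆-length : ∀ {A : Set} {xs ys : List A} → Unique xs → (∀ {x} → x ∈ xs → x ∈ ys) →
    length xs ≤ length ys
  ⊆-length u sub = matching-≤ _≡_ _ _ u (λ x∈ → _ , sub x∈ , refl) (λ { _ _ refl refl → refl })

  AllPairs-All-map : ∀ {A : Set} {P : A → Set} {R S : A → A → Set} →
    (∀ {x y} → P x → P y → R x y → S x y) →
    ∀ {xs} → All P xs → AllPairs R xs → AllPairs S xs
  AllPairs-All-map f []         []         = []
  AllPairs-All-map f (px ∷ pxs) (rs ∷ rss) =
    All.zipWith (λ (py , r) → f px py r) (pxs , rs) ∷ AllPairs-All-map f pxs rss

  -- Cardinality bounds are phrased through arbitrary duplicate-free lists, so that `P` need not be
  -- decidable and bounds combine over unions.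
  AtMost : ∀ {A : Set} → ℕ → (A → Set) → Set
  AtMost n P = ∀ L → Unique L → All P L → length L ≤ n

  atMost-mono : ∀ {A : Set} {m n} {P Q : A → Set} → m ≤ n → (∀ {a} → Q a → P a) →
    AtMost m P → AtMost n Q
  atMost-mono m≤n f b L u q = ≤-trans (b L u (All.map f q)) m≤n

  atMost-keys : ∀ {A B : Set} {P : A → Set} (R : A → B → Set) (K : List B) →
    (∀ {a} → P a → ∃ λ k → k ∈ K × R a k) →
    (∀ {a b k} → P a → P b → R a k → R b k → a ≡ b) → AtMost (length K) P
  atMost-keys R K key inj L u p = matching-≤ R L K u (key ∘ All.lookup p)
    (λ i j → inj (All.lookup p i) (All.lookup p j))

  atMost-list : ∀ {A : Set} {P : A → Set} (K : List A) → (∀ {a} → P a → a ∈ K) → AtMost (length K) P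
  atMost-list K P⊆K L u p = ⊆-length u (P⊆K ∘ All.lookup p)

  -- The inclusion of both parts in `L` is carried along because it is what keeps the parts
  -- duplicate-free in the induction.
  split-⊎ : ∀ {A : Set} {P Q : A → Set} {L} → Unique L → All (λ a → P a ⊎ Q a) L →
    ∃₂ λ M N → (Unique M × All P M) × (Unique N × All Q N) ×
      (∀ {x} → x ∈ M ⊎ x ∈ N → x ∈ L) × length L ≡ length M + length N
  split-⊎ [] [] = [] , [] , ([] , []) , ([] , []) , (λ { (inj₁ ()) ; (inj₂ ()) }) , refl
  split-⊎ (a∉ ∷ u) (pq ∷ pqs) with split-⊎ u pqs
  split-⊎ (a∉ ∷ u) (inj₁ p ∷ pqs) | M , N , (uM , pM) , (uN , qN) , sub , len =
    _ ∷ M , N , (All.tabulate (All.lookup a∉ ∘ sub ∘ inj₁) ∷ uM , p ∷ pM) , (uN , qN) ,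
    (λ { (inj₁ (here e)) → here e ; (inj₁ (there i)) → there (sub (inj₁ i)) ; (inj₂ i) → there (sub (inj₂ i)) }) ,
    cong suc len
  split-⊎ (a∉ ∷ u) (inj₂ q ∷ pqs) | M , N , (uM , pM) , (uN , qN) , sub , len =
    M , _ ∷ N , (uM , pM) , (All.tabulate (All.lookup a∉ ∘ sub ∘ inj₂) ∷ uN , q ∷ qN) ,
    (λ { (inj₂ (here e)) → here e ; (inj₁ i) → there (sub (inj₁ i)) ; (inj₂ (there i)) → there (sub (inj₂ i)) }) ,
    trans (cong suc len) (sym (+-suc (length M) (length N)))

  atMost-⊎ : ∀ {A : Set} {m n} {P Q R : A → Set} → (∀ {a} → R a → P a ⊎ Q a) →
    AtMost m P → AtMost n Q → AtMost (m + n) R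
  atMost-⊎ f bP bQ L u r with split-⊎ u (All.map f r)
  ... | M , N , (uM , pM) , (uN , qN) , _ , len =
    ≤-trans (≤-reflexive len) (+-mono-≤ (bP M uM pM) (bQ N uN qN))

  atMost-⊥ : ∀ {A : Set} {P : A → Set} → (∀ {a} → ¬ P a) → AtMost 0 P
  atMost-⊥ ¬P = atMost-list [] (λ p → contradiction p ¬P)

  atMost-⋃ : ∀ {A B : Set} {R : B → A → Set} (n : B → ℕ) (K : List B) →
    (∀ {k} → k ∈ K → AtMost (n k) (R k)) → AtMost (sum (map n K)) (λ a → Any (λ k → R k a) K)
  atMost-⋃ n []      b = atMost-⊥ λ ()
  atMost-⋃ n (k ∷ K) b = atMost-⊎ (λ { (here r) → inj₁ r ; (there i) → inj₂ i })
    (b (here refl)) (atMost-⋃ n K (b ∘ there))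

  -- Subsets of Fin n as duplicate-free lists

  points : ∀ {n} → Subset n → List (Fin n)
  points []            = []
  points (inside  ∷ B) = zero ∷ map suc (points B)
  points (outside ∷ B) = map suc (points B)

  length-points : ∀ {n} (B : Subset n) → length (points B) ≡ ∣ B ∣
  length-points []            = refl
  length-points (inside  ∷ B) = cong suc (trans (length-map suc (points B)) (length-points B))
  length-points (outside ∷ B) = trans (length-map suc (points B)) (length-points B)

  ∈-points⁺ : ∀ {n} {B : Subset n} {x} → x ∈ₛ B → x ∈ points B
  ∈-points⁺ {B = inside  ∷ B} Vec.here      = here refl
  ∈-points⁺ {B = inside  ∷ B} (Vec.there i) = there (∈-map⁺ suc (∈-points⁺ i))
  ∈-points⁺ {B = outside ∷ B} (Vec.there i) = ∈-map⁺ suc (∈-points⁺ i)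

  ∈-points⁻ : ∀ {n} {B : Subset n} {x} → x ∈ points B → x ∈ₛ B
  ∈-points⁻ {B = inside ∷ B} (here refl) = Vec.here
  ∈-points⁻ {B = inside ∷ B} (there i) with ∈-map⁻ suc i
  ... | _ , j , refl = Vec.there (∈-points⁻ j)
  ∈-points⁻ {B = outside ∷ B} i with ∈-map⁻ suc i
  ... | _ , j , refl = Vec.there (∈-points⁻ j)

  points-unique : ∀ {n} (B : Subset n) → Unique (points B)
  points-unique []            = []
  points-unique (outside ∷ B) = Uniq.map⁺ Fin.suc-injective (points-unique B)
  points-unique (inside  ∷ B) = All.tabulate (λ i 0≡ → 0∉ (subst (_∈ _) (sym 0≡) i)) ∷
    Uniq.map⁺ Fin.suc-injective (points-unique B)
    where
    0∉ : ¬ zero ∈ map suc (points B)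
    0∉ i with ∈-map⁻ suc i
    ... | _ , _ , ()

  length-≤-Fin : ∀ {n} {xs : List (Fin n)} → Unique xs → length xs ≤ n
  length-≤-Fin {n} u = ≤-trans (⊆-length u (λ {x} _ → ∈-allFin x)) (≤-reflexive (length-tabulate {n = n} (λ i → i)))

  -- Pairs of entries from two different lists

  -- Each pair is oriented from the earlier list to the later one, so that it is counted once.
  crossPairs : ∀ {A : Set} → List (List A) → List (A × A)
  crossPairs []        = []
  crossPairs (T ∷ Ts) = cartesianProduct T (concat Ts) ++ crossPairs Ts

  length-cartesianProduct : ∀ {A B : Set} (xs : List A) (ys : List B) →
    length (cartesianProduct xs ys) ≡ length xs * length ys
  length-cartesianProduct []       ys = refl
  length-cartesianProduct (x ∷ xs) ys = trans (length-++ (map (x ,_) ys))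
    (cong₂ _+_ (length-map (x ,_) ys) (length-cartesianProduct xs ys))

  length-concat : ∀ {A : Set} (Ts : List (List A)) → length (concat Ts) ≡ sum (map length Ts)
  length-concat []       = refl
  length-concat (T ∷ Ts) = trans (length-++ T) (cong (length T +_) (length-concat Ts))

  -- Expansion of the square of a sum: the cross terms are twice the number of pairs, the rest are
  -- the squares of the lengths.
  length-crossPairs : ∀ {A : Set} (Ts : List (List A)) →
    2 * length (crossPairs Ts) + sum (map (λ T → length T * length T) Ts)
      ≡ length (concat Ts) * length (concat Ts)
  length-crossPairs []       = refl
  length-crossPairs (T ∷ Ts)
    rewrite length-++ (cartesianProduct T (concat Ts)) {crossPairs Ts}
          | length-cartesianProduct T (concat Ts)
          | length-++ T {concat Ts} =
    trans (expand t c p q) (trans (cong (λ s → t * t + 2 * (t * c) + s) (length-crossPairs Ts)) (square t c))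
    where
    t = length T
    c = length (concat Ts)
    p = length (crossPairs Ts)
    q = sum (map (λ T → length T * length T) Ts)
    expand : ∀ t c p q → 2 * (t * c + p) + (t * t + q) ≡ t * t + 2 * (t * c) + (2 * p + q)
    expand = solve-∀
    square : ∀ t c → t * t + 2 * (t * c) + c * c ≡ (t + c) * (t + c)
    square = solve-∀

  ∈-crossPairs : ∀ {A B : Set} (f : B → List A) {Bs C D x y} → C ∈ Bs → D ∈ Bs → C ≢ D →
    x ∈ f C → y ∈ f D → (x , y) ∈ crossPairs (map f Bs) ⊎ (y , x) ∈ crossPairs (map f Bs)
  ∈-crossPairs f (here refl) (here refl) C≢D x∈ y∈ = contradiction refl C≢D
  ∈-crossPairs f (here refl) (there j)   C≢D x∈ y∈ =
    inj₁ (∈-++⁺ˡ (∈-cartesianProduct⁺ x∈ (∈-concat⁺′ y∈ (∈-map⁺ f j))))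
  ∈-crossPairs f (there i)   (here refl) C≢D x∈ y∈ =
    inj₂ (∈-++⁺ˡ (∈-cartesianProduct⁺ y∈ (∈-concat⁺′ x∈ (∈-map⁺ f i))))
  ∈-crossPairs f {B ∷ Bs} (there i) (there j) C≢D x∈ y∈ with ∈-crossPairs f i j C≢D x∈ y∈
  ... | inj₁ p = inj₁ (∈-++⁺ʳ (cartesianProduct (f B) (concat (map f Bs))) p)
  ... | inj₂ p = inj₂ (∈-++⁺ʳ (cartesianProduct (f B) (concat (map f Bs))) p)

  -- The numerical estimate when some member has no heavy point

  blocks-arithmetic : ∀ {b n g v ρ} h m → m ≢ 0 → h + m ≡ ρ →
    b ≤ n + (13 * m + g) →
    6 * n + h * suc h ≤ 2 * (h * v) →
    2 * g + (9 * ρ + 7 * m) ≡ (3 * ρ + m) * (3 * ρ + m) →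
    27 * (ρ * ρ) + 60 ≤ 2 * v + 3 * ρ →
    6 * b + ρ * suc ρ ≤ 2 * (ρ * v)
  blocks-arithmetic h zero m≢0 = contradiction refl m≢0
  blocks-arithmetic {b} {n} {g} {v} h (suc k) _ refl b≤ n≤ g≡ v-large = +-cancelʳ-≤ c _ _ (begin
    6 * b + ρ * suc ρ + c
      ≤⟨ +-monoˡ-≤ c (+-monoˡ-≤ (ρ * suc ρ) (*-monoʳ-≤ 6 b≤)) ⟩
    6 * (n + (13 * m + g)) + ρ * suc ρ + c
      ≡⟨ collect n g h k ⟩
    (6 * n + h * suc h) + 3 * (2 * g + (9 * ρ + 7 * m)) + (78 * m + ρ * suc ρ + 3 * (m * ρ))
      ≤⟨ +-monoˡ-≤ (78 * m + ρ * suc ρ + 3 * (m * ρ)) (+-mono-≤ n≤ (≤-reflexive (cong (3 *_) g≡))) ⟩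
    2 * (h * v) + 3 * ((3 * ρ + m) * (3 * ρ + m)) + (78 * m + ρ * suc ρ + 3 * (m * ρ))
      ≤⟨ m≤m+n _ slack ⟩
    2 * (h * v) + 3 * ((3 * ρ + m) * (3 * ρ + m)) + (78 * m + ρ * suc ρ + 3 * (m * ρ)) + slack
      ≡⟨ compare v h k ⟩
    m * (27 * (ρ * ρ) + 60) + (2 * (h * v) + (h * suc h + 27 * ρ + 21 * m))
      ≤⟨ +-monoˡ-≤ (2 * (h * v) + (h * suc h + 27 * ρ + 21 * m)) (*-monoʳ-≤ m v-large) ⟩
    m * (2 * v + 3 * ρ) + (2 * (h * v) + (h * suc h + 27 * ρ + 21 * m))
      ≡⟨ recollect v h k ⟩
    2 * (ρ * v) + c ∎)
    where
    open ≤-Reasoning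
    m ρ c slack : ℕ
    m = suc k
    ρ = h + m
    -- Adding `c` to both sides avoids subtraction: `h * suc h` comes from the bound on `n`,
    -- `27 * ρ + 21 * m` from three times the equation for `g`, and `3 * (m * ρ)` from `m` times the
    -- bound on `v`.
    c = h * suc h + 27 * ρ + 21 * m + 3 * (m * ρ)
    -- The difference of the two sides, with ρ and m expressed by h and k so as to be visibly nonnegative.
    slack = k * (2 + 31 * h + 29 * k + 27 * ((h + k) * (h + k))) + 4 * (1 + h + k)
    collect : ∀ n g h k → let m = suc k ; ρ = h + m in
      6 * (n + (13 * m + g)) + ρ * suc ρ + (h * suc h + 27 * ρ + 21 * m + 3 * (m * ρ)) ≡
      (6 * n + h * suc h) + 3 * (2 * g + (9 * ρ + 7 * m)) + (78 * m + ρ * suc ρ + 3 * (m * ρ))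
    collect = solve-∀
    compare : ∀ v h k → let m = suc k ; ρ = h + m in
      2 * (h * v) + 3 * ((3 * ρ + m) * (3 * ρ + m)) + (78 * m + ρ * suc ρ + 3 * (m * ρ)) +
        (k * (2 + 31 * h + 29 * k + 27 * ((h + k) * (h + k))) + 4 * (1 + h + k)) ≡
      m * (27 * (ρ * ρ) + 60) + (2 * (h * v) + (h * suc h + 27 * ρ + 21 * m))
    compare = solve-∀
    recollect : ∀ v h k → let m = suc k ; ρ = h + m in
      m * (2 * v + 3 * ρ) + (2 * (h * v) + (h * suc h + 27 * ρ + 21 * m)) ≡
      2 * (ρ * v) + (h * suc h + 27 * ρ + 21 * m + 3 * (m * ρ))
    recollect = solve-∀

  -- Filtering, deletion and disjointness

  length-filter-∁ : ∀ {A : Set} {P : A → Set} (P? : Decidable P) xs →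
    length (filter P? xs) + length (filter (¬? ∘ P?) xs) ≡ length xs
  length-filter-∁ P? [] = refl
  length-filter-∁ P? (x ∷ xs) with P? x
  ... | yes _ = cong suc (length-filter-∁ P? xs)
  ... | no  _ = trans (+-suc _ _) (cong suc (length-filter-∁ P? xs))

  length-delete : ∀ {A : Set} (_≟_ : DecidableEquality A) {x xs} → Unique xs → x ∈ xs →
    suc (length (filter (λ y → ¬? (y ≟ x)) xs)) ≡ length xs
  length-delete _≟_ {x} {xs} u x∈xs = ≤-antisym
    (⊆-length (All.tabulate (λ i x≡y → proj₂ (∈-filter⁻ ≢x? {xs = xs} i) (sym x≡y)) ∷ Uniq.filter⁺ ≢x? u)
      (λ { (here refl) → x∈xs ; (there i) → proj₁ (∈-filter⁻ ≢x? i) }))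
    (⊆-length u delete⁺)
    where
    ≢x? : Decidable (λ y → ¬ y ≡ x)
    ≢x? y = ¬? (y ≟ x)
    delete⁺ : ∀ {y} → y ∈ xs → y ∈ x ∷ filter ≢x? xs
    delete⁺ {y} i with y ≟ x
    ... | yes y≡x = here y≡x
    ... | no  y≢x = there (∈-filter⁺ ≢x? i y≢x)

  _≟ₛ_ : ∀ {n} → DecidableEquality (Subset n)
  _≟ₛ_ = Vec.≡-dec Bool._≟_

  Disjoint : ∀ {n} → Subset n → Subset n → Set
  Disjoint A B = ∀ {x} → x ∈ₛ A → x ∉ₛ B

  -- Packings with block size 4

  module _ {v} (𝓟 : Packing v 4) where

    Block : Subset v → Set
    Block A = A ∈ blocks 𝓟

    others : Fin v → Subset v → List (Fin v)
    others x A = filter (λ y → ¬? (y Fin.≟ x)) (points A)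

    ∈-others⁺ : ∀ {x y A} → y ∈ₛ A → y ≢ x → y ∈ others x A
    ∈-others⁺ y∈A = ∈-filter⁺ _ (∈-points⁺ y∈A)

    ∈-others⁻ : ∀ {x y A} → y ∈ others x A → y ∈ₛ A × y ≢ x
    ∈-others⁻ {A = A} i with ∈-filter⁻ _ {xs = points A} i
    ... | y∈ , y≢x = ∈-points⁻ y∈ , y≢x

    length-block : ∀ {A} → Block A → length (points A) ≡ 4
    length-block {A} A∈ = trans (length-points A) (block-size 𝓟 A∈)

    length-others : ∀ {x A} → Block A → x ∈ₛ A → length (others x A) ≡ 3
    length-others {A = A} A∈ x∈A = cong (_∸ 1)
      (trans (length-delete Fin._≟_ (points-unique A) (∈-points⁺ x∈A)) (length-block A∈))

    length-concat-others : ∀ {x L} → All (λ A → Block A × x ∈ₛ A) L →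
      length (concat (map (others x) L)) ≡ 3 * length L
    length-concat-others [] = refl
    length-concat-others {x} {A ∷ L} ((A∈ , x∈A) ∷ p) = trans (length-++ (others x A))
      (trans (cong₂ _+_ (length-others A∈ x∈A) (length-concat-others p)) (sym (*-suc 3 (length L))))

    -- Two blocks through `x` share no other point, so the blocks of `L` contribute disjoint
    -- triples. Together with `x` and `Q` these are distinct points of `Fin v`.
    star-≤ : ∀ {x Q L} → Unique Q → x ∉ Q → Unique L →
      All (λ A → (Block A × x ∈ₛ A) × (∀ {y} → y ∈ₛ A → y ∉ Q)) L →
      3 * length L + suc (length Q) ≤ v
    star-≤ {x} {Q} {L} uQ x∉Q uL pL = ≤-trans (≤-reflexive (sym len)) (length-≤-Fin uAll)
      where
      pencil = concat (map (others x) L)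
      ∈-pencil : ∀ {y} → y ∈ pencil → ∃ λ A → A ∈ L × y ∈ₛ A × y ≢ x
      ∈-pencil i with ∈-concat⁻′ (map (others x) L) i
      ... | _ , y∈ , j with ∈-map⁻ (others x) j
      ... | A , A∈L , refl with ∈-others⁻ {A = A} y∈
      ... | y∈A , y≢x = A , A∈L , y∈A , y≢x
      uPencil : Unique pencil
      uPencil = Uniq.concat⁺
        (All.map⁺ (All.tabulate λ {A} _ → Uniq.filter⁺ _ (points-unique A)))
        (AllPairs.map⁺ (AllPairs-All-map
          (λ { {A} {B} (pA , x∈A) (pB , x∈B) A≢B (i , j) →
               let y∈A , y≢x = ∈-others⁻ {A = A} i
                   y∈B , _   = ∈-others⁻ {A = B} j
               in A≢B (pair 𝓟 y≢x pA pB y∈A x∈A y∈B x∈B) })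
          (All.map proj₁ pL) uL))
      uAll : Unique (Q ++ x ∷ pencil)
      uAll = Uniq.++⁺ uQ (All.tabulate (λ i x≡y → proj₂ (proj₂ (proj₂ (∈-pencil i))) (sym x≡y)) ∷ uPencil)
        λ { (y∈Q , here refl) → x∉Q y∈Q
          ; (y∈Q , there i) → let _ , A∈L , y∈A , _ = ∈-pencil i in proj₂ (All.lookup pL A∈L) y∈A y∈Q }
      len : length (Q ++ x ∷ pencil) ≡ 3 * length L + suc (length Q)
      len = trans (length-++ Q) (trans (cong (λ n → length Q + suc n) (length-concat-others (All.map proj₁ pL)))
        (swap (length Q) (3 * length L)))
        where
        swap : ∀ q l → q + suc l ≡ l + suc q
        swap = solve-∀

    -- Classify the blocks by the last point of H on them: those through x that miss the
    -- h later points partition at most v - 1 - h points into triples.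
    meeting-bound : ∀ H → Unique H → ∃ λ n →
      AtMost n (λ A → Block A × Any (_∈ₛ A) H) ×
      6 * n + length H * suc (length H) ≤ 2 * (length H * v)
    meeting-bound [] _ = 0 , atMost-⊥ (λ ()) , z≤n
    meeting-bound (x ∷ H) uxH@(x∉H ∷ uH) with meeting-bound H uH
    ... | n , bH , le = k + n , atMost-⊎ first bx bH , le′
      where
      h = length H
      k = (v ∸ suc h) / 3
      Px : Subset v → Set
      Px A = (Block A × x ∈ₛ A) × (∀ {y} → y ∈ₛ A → y ∉ H)
      first : ∀ {A} → Block A × Any (_∈ₛ A) (x ∷ H) → Px A ⊎ (Block A × Any (_∈ₛ A) H)
      first {A} (A∈ , i) with Any.any? (_∈? A) H
      first (A∈ , i)       | yes j = inj₂ (A∈ , j)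
      first (A∈ , here x∈) | no ¬j = inj₁ ((A∈ , x∈) , λ y∈A y∈H → ¬j (lose y∈H y∈A))
      first (A∈ , there i) | no ¬j = contradiction i ¬j
      bx : AtMost k Px
      bx L uL pL = ≤-trans (≤-reflexive (sym (m*n/n≡m (length L) 3))) (/-monoˡ-≤ 3
        (≤-trans (≤-reflexive (*-comm (length L) 3)) (m+n≤o⇒m≤o∸n _
          (star-≤ uH (λ i → All.lookup x∉H i refl) uL pL))))
      -- The list `x ∷ H` is duplicate-free, so `suc h` is at most `v` and the truncated subtraction
      -- in `k` is exact.
      3k : k * 3 + suc h ≤ v
      3k = ≤-trans (+-monoˡ-≤ (suc h) (m/n*n≤m (v ∸ suc h) 3)) (≤-reflexive (m∸n+n≡m (length-≤-Fin uxH)))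
      le′ : 6 * (k + n) + suc h * suc (suc h) ≤ 2 * (suc h * v)
      le′ = ≤-trans (≤-reflexive (regroup k n h))
        (≤-trans (+-mono-≤ (*-monoʳ-≤ 2 3k) le) (≤-reflexive (sym (*-distribˡ-+ 2 v (h * v)))))
        where
        regroup : ∀ k n h → 6 * (k + n) + suc h * suc (suc h) ≡ 2 * (k * 3 + suc h) + (6 * n + h * suc h)
        regroup = solve-∀

    -- A point other than `x` lies on at most one block through `x`, so each point of `F` spoils at
    -- most one block of `L`.
    avoiding : ∀ {x L} F → Unique L → All (λ A → Block A × x ∈ₛ A) L → length F < length L →
      ∃ λ A → A ∈ L × (∀ {y} → y ∈ₛ A → y ∈ F → y ≡ x)
    avoiding {x} {L} F uL pL F<L with All.all? hits? L
      where
      hits? : Decidable (λ A → Any (λ y → y ∈ₛ A × y ≢ x) F)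
      hits? A = Any.any? (λ y → (y ∈? A) ×-dec ¬? (y Fin.≟ x)) F
    ... | yes hits = contradiction (matching-≤ (λ A y → y ∈ₛ A × y ≢ x) L F uL
            (λ i → find (All.lookup hits i))
            λ { i j (y∈A , y≢x) (y∈B , _) → pair 𝓟 y≢x (proj₁ (All.lookup pL i)) (proj₁ (All.lookup pL j))
                  y∈A (proj₂ (All.lookup pL i)) y∈B (proj₂ (All.lookup pL j)) })
            (<⇒≱ F<L)
    ... | no ¬hits with find (All.¬All⇒Any¬ (λ A → Any.any? (λ y → (y ∈? A) ×-dec ¬? (y Fin.≟ x)) F) L ¬hits)
    ... | A , A∈L , ¬hit = A , A∈L , λ {y} y∈A y∈F →
            decidable-stable (y Fin.≟ x) (λ y≢x → ¬hit (lose y∈F (y∈A , y≢x)))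

    -- Consequences of maximality

    module _ {P : List (Subset v)} (ppc : IsPPC 𝓟 P) (max : ¬ HasPPCOfSize 𝓟 (length P + 1)) where

      Covered : Fin v → Set
      Covered y = Any (y ∈ₛ_) P

      Covered? : Decidable Covered
      Covered? y = Any.any? (y ∈?_) P

      same : ∀ {A B x} → A ∈ P → B ∈ P → x ∈ₛ A → x ∈ₛ B → A ≡ B
      same {A} {B} A∈ B∈ x∈A x∈B with A ≟ₛ B
      ... | yes A≡B = A≡B
      ... | no  A≢B = contradiction (_ , x∈p∩q⁺ (x∈A , x∈B)) (ppc-disjoint ppc A∈ B∈ A≢B)

      P-disjoint : AllPairs Disjoint P
      P-disjoint = AllPairs-All-map {S = Disjoint} (λ A∈ B∈ A≢B x∈A x∈B → A≢B (same A∈ B∈ x∈A x∈B))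
        (All.tabulate (λ i → i)) (ppc-unique ppc)

      -- The form in which maximality is applied. Distinctness need not be supplied: blocks are
      -- nonempty, so disjoint ones differ.
      too-large : ∀ {Q} → All Block Q → AllPairs Disjoint Q → length Q ≡ suc (length P) → ⊥
      too-large {Q} Q∈ dj len = max (Q , record
        { ppc-unique   = AllPairs-All-map {R = Disjoint}
            (λ { A∈ _ A∩A refl → nonempty A∈ A∩A }) Q∈ dj
        ; ppc-blocks   = All.lookup Q∈
        ; ppc-disjoint = λ {A} {B} i j A≢B (x , x∈) → let x∈A , x∈B = x∈p∩q⁻ A B x∈ in meet dj i j A≢B x∈A x∈B
        } , trans len (sym (+-comm (length P) 1)))
        where
        nonempty : ∀ {A} → Block A → ¬ Disjoint A A
        nonempty {A} A∈ A∩A with points A in eq | length-block A∈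
        ... | x ∷ _ | _ = let x∈A = ∈-points⁻ (subst (x ∈_) (sym eq) (here refl)) in A∩A x∈A x∈A
        meet : ∀ {Q A B} → AllPairs Disjoint Q → A ∈ Q → B ∈ Q → A ≢ B → Disjoint A B
        meet (d ∷ dj) (here refl) (here refl) A≢B = contradiction refl A≢B
        meet (d ∷ dj) (here refl) (there j)   A≢B = All.lookup d j
        meet (d ∷ dj) (there i)   (here refl) A≢B x∈A x∈B = All.lookup d i x∈B x∈A
        meet (d ∷ dj) (there i)   (there j)   A≢B = meet dj i j A≢B

      meets-P : ∀ {A} → Block A → ∃ λ x → x ∈ₛ A × Covered x
      meets-P {A} A∈ with Fin.any? (λ x → (x ∈? A) ×-dec Covered? x)
      ... | yes p = p
      ... | no ¬p = contradiction refl (too-large {A ∷ P} (A∈ ∷ All.tabulate (ppc-blocks ppc))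
            (All.tabulate (λ B∈ x∈A x∈B → ¬p (_ , x∈A , lose B∈ x∈B)) ∷ P-disjoint))

      -- Tangents and heavy points

      Tangent : Fin v → Subset v → Set
      Tangent x A = x ∈ₛ A × (∀ y → y ∈ₛ A → Covered y → y ≡ x)

      Tangent? : ∀ x → Decidable (Tangent x)
      Tangent? x A = (x ∈? A) ×-dec Fin.all? (λ y → (y ∈? A) →-dec (Covered? y →-dec (y Fin.≟ x)))

      tangents : Fin v → List (Subset v)
      tangents x = filter (Tangent? x) (blocks 𝓟)

      ∈-tangents⁻ : ∀ {x A} → A ∈ tangents x → Block A × Tangent x A
      ∈-tangents⁻ {x} = ∈-filter⁻ (Tangent? x)

      tangent-avoiding : ∀ {x} F → length F < length (tangents x) →
        ∃ λ A → Block A × Tangent x A × (∀ {y} → y ∈ₛ A → y ∈ F → y ≡ x)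
      tangent-avoiding {x} F F< with avoiding F (Uniq.filter⁺ (Tangent? x) (unique 𝓟))
        (All.tabulate (λ i → let A∈ , x∈A , _ = ∈-tangents⁻ i in A∈ , x∈A)) F<
      ... | A , i , avoids = let A∈ , t = ∈-tangents⁻ i in A , A∈ , t , avoids

      -- Otherwise B could be exchanged for A and a tangent at x disjoint from A.
      tangents-exclusive : ∀ {B x y A} → B ∈ P → x ∈ₛ B → y ∈ₛ B → x ≢ y →
        4 ≤ length (tangents x) → Block A → ¬ Tangent y A
      tangents-exclusive {B} {x} {y} {A} B∈ x∈B y∈B x≢y 4≤ A∈ (y∈A , tA)
        -- Four tangents at `x` outnumber the three points of `A` other than `y`, so some tangent
        -- `N` avoids them.
        with tangent-avoiding (others y A) (subst (_< length (tangents x)) (sym (length-others A∈ y∈A)) 4≤)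
      ... | N , N∈ , (x∈N , tN) , avoids = too-large
          (N∈ ∷ A∈ ∷ All.tabulate (ppc-blocks ppc ∘ proj₁ ∘ ∈-rest⁻))
          ((N-A ∷ All.tabulate (off x∈B tN)) ∷ All.tabulate (off y∈B tA) ∷ AllPairs.filter⁺ ≢B? P-disjoint)
          (cong suc (length-delete _≟ₛ_ (ppc-unique ppc) B∈))
        where
        ≢B? : Decidable (λ C → ¬ C ≡ B)
        ≢B? C = ¬? (C ≟ₛ B)
        ∈-rest⁻ : ∀ {C} → C ∈ filter ≢B? P → C ∈ P × C ≢ B
        ∈-rest⁻ = ∈-filter⁻ ≢B?
        N-A : Disjoint N A
        N-A {z} z∈N z∈A with z Fin.≟ y
        ... | yes refl = x≢y (sym (tN z z∈N (lose B∈ y∈B)))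
        ... | no z≢y with avoids z∈N (∈-others⁺ {A = A} z∈A z≢y)
        ... | refl = x≢y (tA z z∈A (lose B∈ x∈B))
        off : ∀ {z M C} → z ∈ₛ B → (∀ u → u ∈ₛ M → Covered u → u ≡ z) → C ∈ filter ≢B? P → Disjoint M C
        off z∈B tM i {u} u∈M u∈C with ∈-rest⁻ i
        ... | C∈ , C≢B with tM u u∈M (lose C∈ u∈C)
        ... | refl = C≢B (same C∈ B∈ u∈C z∈B)

      -- 13 exceeds the 12 points to be avoided in replace-block, while 12 tangents at a single
      -- non-heavy point are no more than 3 tangents at each of the 4 points of a block.
      Heavy : Fin v → Set
      Heavy x = 13 ≤ length (tangents x)

      Heavy? : Decidable Heavy
      Heavy? x = 13 ≤? length (tangents x)

      -- State of the exchange that makes room for a block A: each member of Q meeting A has been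
      -- replaced by a tangent at its heavy point.  Every replacement uses up a point of A, and
      -- the next tangent has to avoid the uncovered points (forbidden) of A and of its predecessors.
      record Replacement (A : Subset v) (Q : List (Subset v)) : Set where
        field
          new            : List (Subset v)
          new-length     : length new ≡ length Q
          new-blocks     : All Block new
          new-disjoint   : AllPairs Disjoint (A ∷ new)
          new-covered    : ∀ {E z} → E ∈ new → z ∈ₛ E → Covered z → Any (z ∈ₛ_) Q
          used           : List (Fin v)
          used-unique    : Unique used
          used⊆A         : All (_∈ₛ A) used
          used⊆Q         : All (λ z → Any (z ∈ₛ_) Q) used
          forbidden      : List (Fin v)
          -- Three points of `A` beside one covered point, and three points of each tangent beside
          -- its heavy point.
          forbidden-size : length forbidden ≡ 3 + 3 * length used
          uncovered      : ∀ {E z} → E ∈ A ∷ new → z ∈ₛ E → Covered z ⊎ z ∈ forbidden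

      rest-misses : ∀ {B Q z} → All (B ≢_) Q → (∀ {C} → C ∈ B ∷ Q → C ∈ P) → z ∈ₛ B → ¬ Any (z ∈ₛ_) Q
      rest-misses B∉Q ⊆P z∈B i with find i
      ... | C , C∈Q , z∈C = All.lookup B∉Q C∈Q (same (⊆P (here refl)) (⊆P (there C∈Q)) z∈B z∈C)

      -- Covered points of the new blocks lie on members in `Q`, hence off `B`.
      keep-block : ∀ {A B Q} → Disjoint A B → All (B ≢_) Q → (∀ {C} → C ∈ B ∷ Q → C ∈ P) →
        Replacement A Q → Replacement A (B ∷ Q)
      keep-block {A} {B} {Q} A-B B∉Q ⊆P R = record
        { new            = B ∷ new
        ; new-length     = cong suc new-length
        ; new-blocks     = ppc-blocks ppc B∈P ∷ new-blocks
        ; new-disjoint   = (A-B ∷ AllPairs.head new-disjoint)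
            ∷ All.tabulate (λ i z∈B z∈E → rest-misses B∉Q ⊆P z∈B (new-covered i z∈E (lose B∈P z∈B)))
            ∷ AllPairs.tail new-disjoint
        ; new-covered    = λ { (here refl) z∈E _ → here z∈E ; (there i) z∈E c → there (new-covered i z∈E c) }
        ; used           = used
        ; used-unique    = used-unique
        ; used⊆A         = used⊆A
        ; used⊆Q         = All.map there used⊆Q
        ; forbidden      = forbidden
        ; forbidden-size = forbidden-size
        ; uncovered      = λ { (here refl)         → uncovered (here refl)
                             ; (there (here refl)) → inj₁ ∘ lose B∈P
                             ; (there (there i))   → uncovered (there i) }
        }
        where
        open Replacement R
        B∈P = ⊆P (here refl)

      replace-block : ∀ {A B Q a x} → Block A → a ∈ₛ A → a ∈ₛ B → x ∈ₛ B → Heavy x → x ∉ₛ A →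
        All (B ≢_) Q → (∀ {C} → C ∈ B ∷ Q → C ∈ P) → Replacement A Q → Replacement A (B ∷ Q)
      replace-block {A} {B} {Q} {a} {x} A∈ a∈A a∈B x∈B hx x∉A B∉Q ⊆P R
        with tangent-avoiding forbidden (≤-trans (s≤s forbidden≤) hx)
        where
        open Replacement R
        -- The point `a` is on `B` and the used points are on other members, so `a` is a further
        -- point of `A`. Hence at most three points were used before, and at most 3 + 3 * 3 = 12 are
        -- forbidden.
        used≤ : suc (length used) ≤ 4
        used≤ = subst (suc (length used) ≤_) (length-block A∈) (⊆-length
          (All.tabulate (λ { i refl → rest-misses B∉Q ⊆P a∈B (All.lookup used⊆Q i) }) ∷ used-unique)
          (λ { (here refl) → ∈-points⁺ a∈A ; (there i) → ∈-points⁺ (All.lookup used⊆A i) }))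
        forbidden≤ : length forbidden ≤ 12
        forbidden≤ = ≤-trans (≤-reflexive (trans forbidden-size (sym (*-suc 3 _)))) (*-monoʳ-≤ 3 used≤)
      ... | N , N∈ , (x∈N , tN) , avoids = record
        { new            = N ∷ new
        ; new-length     = cong suc new-length
        ; new-blocks     = N∈ ∷ new-blocks
        ; new-disjoint   = ((λ z∈A z∈N → N-misses (here refl) z∈N z∈A) ∷ AllPairs.head new-disjoint)
            ∷ All.tabulate (λ i → N-misses (there i))
            ∷ AllPairs.tail new-disjoint
        ; new-covered    = λ { (here refl) z∈N c → here (subst (_∈ₛ B) (sym (tN _ z∈N c)) x∈B)
                             ; (there i) z∈E c → there (new-covered i z∈E c) }
        ; used           = a ∷ used
        ; used-unique    = All.tabulate (λ { i refl → rest-misses B∉Q ⊆P a∈B (All.lookup used⊆Q i) }) ∷ used-unique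
        ; used⊆A         = a∈A ∷ used⊆A
        ; used⊆Q         = here a∈B ∷ All.map there used⊆Q
        ; forbidden      = others x N ++ forbidden
        ; forbidden-size = trans (length-++ (others x N)) (trans
            (cong₂ _+_ (length-others N∈ x∈N) forbidden-size) (cong (3 +_) (sym (*-suc 3 (length used)))))
        ; uncovered      = λ { (here refl) → [ inj₁ , inj₂ ∘ ∈-++⁺ʳ (others x N) ]′ ∘ uncovered (here refl)
                             ; (there (here refl)) → N-uncovered
                             ; (there (there i)) → [ inj₁ , inj₂ ∘ ∈-++⁺ʳ (others x N) ]′ ∘ uncovered (there i) }
        }
        where
        open Replacement R
        B∈P = ⊆P (here refl)
        x∉ : ∀ {E} → E ∈ A ∷ new → x ∉ₛ E
        x∉ (here refl) = x∉A
        x∉ (there i) x∈E = rest-misses B∉Q ⊆P x∈B (new-covered i x∈E (lose B∈P x∈B))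
        -- A common point is covered, hence equal to `x` by tangency, or forbidden, hence equal to
        -- `x` by the choice of `N`. But `x` lies neither on `A` nor on an earlier new block.
        N-misses : ∀ {E} → E ∈ A ∷ new → Disjoint N E
        N-misses i z∈N z∈E with [ tN _ z∈N , avoids z∈N ]′ (uncovered i z∈E)
        ... | refl = x∉ i z∈E
        N-uncovered : ∀ {z} → z ∈ₛ N → Covered z ⊎ z ∈ others x N ++ forbidden
        N-uncovered {z} z∈N with z Fin.≟ x
        ... | yes refl = inj₁ (lose B∈P x∈B)
        ... | no  z≢x  = inj₂ (∈-++⁺ˡ (∈-others⁺ {A = N} z∈N z≢x))

      replace : ∀ {A} → Block A → ∀ Q → Unique Q → (∀ {B} → B ∈ Q → B ∈ P) →
        (∀ {B} → B ∈ Q → ∃ λ x → x ∈ₛ B × Heavy x × x ∉ₛ A) → Replacement A Q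
      -- By maximality one of the four points of `A` is covered, so only the other three are
      -- forbidden at the start.
      replace {A} A∈ [] _ _ _ with meets-P A∈
      ... | a , a∈A , ca = record
        { new = [] ; new-length = refl ; new-blocks = [] ; new-disjoint = [] ∷ [] ; new-covered = λ ()
        ; used = [] ; used-unique = [] ; used⊆A = [] ; used⊆Q = []
        ; forbidden = others a A ; forbidden-size = length-others A∈ a∈A ; uncovered = unc }
        where
        unc : ∀ {E z} → E ∈ A ∷ [] → z ∈ₛ E → Covered z ⊎ z ∈ others a A
        unc {z = z} (here refl) z∈A with z Fin.≟ a
        ... | yes refl = inj₁ ca
        ... | no  z≢a  = inj₂ (∈-others⁺ {A = A} z∈A z≢a)
      replace {A} A∈ (B ∷ Q) (B∉Q ∷ uQ) ⊆P heavy
        with Fin.any? (λ a → (a ∈? A) ×-dec (a ∈? B))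
      ... | no ¬meet = keep-block (λ z∈A z∈B → ¬meet (_ , z∈A , z∈B)) B∉Q ⊆P
            (replace A∈ Q uQ (⊆P ∘ there) (heavy ∘ there))
      ... | yes (a , a∈A , a∈B) with heavy (here refl)
      ... | x , x∈B , hx , x∉A = replace-block A∈ a∈A a∈B x∈B hx x∉A B∉Q ⊆P
            (replace A∈ Q uQ (⊆P ∘ there) (heavy ∘ there))

      -- The exchange preserves the number of blocks, so adding `A` would give a PPC larger than
      -- `P`.
      heavy-met : ∀ {A} → Block A → ¬ (∀ {B} → B ∈ P → ∃ λ x → x ∈ₛ B × Heavy x × x ∉ₛ A)
      heavy-met A∈ heavy = too-large (A∈ ∷ new-blocks) new-disjoint (cong suc new-length)
        where open Replacement (replace A∈ P (ppc-unique ppc) (λ i → i) heavy)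

      -- Heavy and light points on the members of `P`

      heavies lights : Subset v → List (Fin v)
      heavies B = filter Heavy? (points B)
      lights  B = filter (¬? ∘ Heavy?) (points B)

      HeavyPattern LightPattern : Subset v → Set
      HeavyPattern B = length (heavies B) ≡ 1 × length (lights B) ≡ 3
      LightPattern B = length (heavies B) ≡ 0 × length (lights B) ≡ 4

      -- For a member of `P` this is 1 if it has no heavy point and 0 otherwise. As a number it can
      -- be summed over `P`.
      lightness : Subset v → ℕ
      lightness B = length (lights B) ∸ 3

      heavies⁻ : ∀ {B x} → x ∈ heavies B → x ∈ₛ B × Heavy x
      heavies⁻ {B} i with ∈-filter⁻ Heavy? {xs = points B} i
      ... | x∈ , hx = ∈-points⁻ x∈ , hx

      heavies⁺ : ∀ {B x} → x ∈ₛ B → Heavy x → x ∈ heavies B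
      heavies⁺ x∈B = ∈-filter⁺ Heavy? (∈-points⁺ x∈B)

      heavies-unique : ∀ B → Unique (heavies B)
      heavies-unique B = Uniq.filter⁺ Heavy? (points-unique B)

      heavy-tangent : ∀ {x} → Heavy x → ∃ λ A → Block A × Tangent x A
      heavy-tangent {x} hx with tangents x in eq | hx
      ... | A ∷ _ | _ = A , ∈-tangents⁻ (subst (A ∈_) (sym eq) (here refl))

      -- With two heavy points on `B`, a tangent at the second would contradict `tangents-exclusive`
      -- for the first.
      pattern? : ∀ {B} → B ∈ P → HeavyPattern B ⊎ LightPattern B
      pattern? {B} B∈ = count (heavies B) (heavies-unique B) heavies⁻
        (trans (length-filter-∁ Heavy? (points B)) (length-block (ppc-blocks ppc B∈)))
        where
        count : ∀ hs {l} → Unique hs → (∀ {x} → x ∈ hs → x ∈ₛ B × Heavy x) → length hs + l ≡ 4 →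
          (length hs ≡ 1 × l ≡ 3) ⊎ (length hs ≡ 0 × l ≡ 4)
        count []          u h eq = inj₂ (refl , eq)
        count (x ∷ [])    u h eq = inj₁ (refl , cong (_∸ 1) eq)
        count (x ∷ y ∷ _) ((x≢y ∷ _) ∷ _) h eq =
          let x∈B , hx = h (here refl)
              y∈B , hy = h (there (here refl))
              _ , A∈ , t = heavy-tangent hy
          in contradiction t (tangents-exclusive B∈ x∈B y∈B x≢y (≤-trans (m≤m+n 4 9) hx) A∈)

      H : List (Fin v)
      H = concat (map heavies P)

      H-unique : Unique H
      H-unique = Uniq.concat⁺
        (All.map⁺ (All.tabulate (λ {B} _ → heavies-unique B)))
        (AllPairs.map⁺ (AllPairs-All-map {R = _≢_}
          (λ { B∈ C∈ B≢C (i , j) → B≢C (same B∈ C∈ (proj₁ (heavies⁻ i)) (proj₁ (heavies⁻ j))) })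
          (All.tabulate (λ i → i)) (ppc-unique ppc)))

      H-meets : ∀ {A B x} → B ∈ P → x ∈ₛ B → Heavy x → x ∈ₛ A → Any (_∈ₛ A) H
      H-meets B∈ x∈B hx x∈A = lose (∈-concat⁺′ (heavies⁺ x∈B hx) (∈-map⁺ heavies B∈)) x∈A

      no-heavies : ∀ {B x} → length (heavies B) ≡ 0 → x ∈ₛ B → ¬ Heavy x
      no-heavies {B} h≡0 x∈B hx with heavies B | heavies⁺ {B} x∈B hx
      ... | _ ∷ _ | _ = contradiction h≡0 λ ()

      -- Blocks without heavy points

      -- The blocks charged to a member without heavy points; nothing is charged to the other
      -- members.
      Extra : Subset v → Subset v → Set
      Extra B A = length (heavies B) ≡ 0 × (A ≡ B ⊎ (Block A × Any (λ x → Tangent x A) (points B)))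

      atMost-Tangent : ∀ x → AtMost (length (tangents x)) (λ A → Block A × Tangent x A)
      atMost-Tangent x = atMost-list (tangents x) (λ (A∈ , t) → ∈-filter⁺ (Tangent? x) A∈ t)

      -- The 13 is `B` itself and 12 tangents: if some point of `B` has at least four, all tangents
      -- at `B` are there, and otherwise each of the four points has at most three.
      extra-bound : ∀ {B} → B ∈ P → AtMost (13 * lightness B) (Extra B)
      extra-bound {B} B∈ with pattern? B∈
      ... | inj₁ (h≡1 , _) = atMost-mono z≤n (λ e → e) (atMost-⊥ (λ (h≡0 , _) → 1≢0 (trans (sym h≡1) h≡0)))
        where
        1≢0 : 1 ≢ 0
        1≢0 ()
      ... | inj₂ (h≡0 , l≡4) rewrite l≡4 = atMost-⊎ proj₂ (atMost-list (B ∷ []) here) tangents≤12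
        where
        Touching : Subset v → Set
        Touching A = Block A × Any (λ x → Tangent x A) (points B)
        few : ∀ {x} → x ∈ points B → length (tangents x) ≤ 12
        few {x} x∈ with Heavy? x
        ... | no ¬h = ≤-pred (≰⇒> ¬h)
        ... | yes h = contradiction h (no-heavies {B} h≡0 (∈-points⁻ x∈))
        sum≤ : ∀ (f : Fin v → ℕ) c xs → (∀ {x} → x ∈ xs → f x ≤ c) → sum (map f xs) ≤ length xs * c
        sum≤ f c []       b = z≤n
        sum≤ f c (x ∷ xs) b = +-mono-≤ (b (here refl)) (sum≤ f c xs (b ∘ there))
        tangents≤12 : AtMost 12 Touching
        tangents≤12 with Any.any? (λ x → 4 ≤? length (tangents x)) (points B)
        ... | yes p with find p
        ... | x , x∈ , 4≤ = atMost-mono (few x∈) only (atMost-Tangent x)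
          where
          only : ∀ {A} → Touching A → Block A × Tangent x A
          only (A∈ , i) with find i
          ... | y , y∈ , t with x Fin.≟ y
          ... | yes refl = A∈ , t
          ... | no x≢y = contradiction t
                (tangents-exclusive B∈ (∈-points⁻ x∈) (∈-points⁻ y∈) x≢y 4≤ A∈)
        tangents≤12 | no ¬p = atMost-mono
          (≤-trans (sum≤ (length ∘ tangents) 3 (points B) (λ x∈ → ≤-pred (≰⇒> (λ 4≤ → ¬p (lose x∈ 4≤)))))
            (≤-reflexive (cong (_* 3) (length-block (ppc-blocks ppc B∈)))))
          (λ (A∈ , i) → Any.map (A∈ ,_) i)
          (atMost-⋃ (length ∘ tangents) (points B) (λ {x} _ → atMost-Tangent x))

      K : List (Fin v × Fin v)
      K = crossPairs (map lights P)

      Joined : Subset v → Fin v × Fin v → Set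
      Joined A (x , y) = x ≢ y × x ∈ₛ A × y ∈ₛ A

      -- A pair of distinct points determines the block through it, so the pairs in `K` serve as
      -- keys.
      joined-bound : AtMost (length K) (λ A → Block A × (∃ λ k → k ∈ K × Joined A k))
      joined-bound = atMost-keys Joined K proj₂
        (λ { (A∈ , _) (B∈ , _) (x≢y , x∈A , y∈A) (_ , x∈B , y∈B) → pair 𝓟 x≢y A∈ B∈ x∈A y∈A x∈B y∈B })

      lights⁺ : ∀ {B x} → x ∈ₛ B → ¬ Heavy x → x ∈ lights B
      lights⁺ x∈B = ∈-filter⁺ (¬? ∘ Heavy?) (∈-points⁺ x∈B)

      light-pattern : ∀ {B} → B ∈ P → (∀ {x} → x ∈ₛ B → ¬ Heavy x) → length (heavies B) ≡ 0
      light-pattern {B} B∈ ¬h with heavies B | (λ {x} → heavies⁻ {B} {x})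
      ... | []    | _  = refl
      ... | x ∷ _ | h⁻ = let x∈B , hx = h⁻ (here refl) in contradiction hx (¬h x∈B)

      -- Maximality gives a covered point `x` of `A`, on a member `B`. The cases are whether `A` has
      -- a second covered point, and whether that point is also on `B`.
      classify : ∀ {A} → Block A → ¬ Any (_∈ₛ A) H →
        Any (λ B → Extra B A) P ⊎ (Block A × (∃ λ k → k ∈ K × Joined A k))
      classify {A} A∈ ¬H with meets-P A∈
      ... | x , x∈A , cx with find cx
      ... | B , B∈ , x∈B with Fin.any? (λ y → (y ∈? A) ×-dec (Covered? y ×-dec ¬? (y Fin.≟ x)))
      ... | no ¬second = inj₁ (lose B∈ (light-pattern B∈ none , inj₂ (A∈ , lose (∈-points⁺ x∈B) t)))
        where
        t : Tangent x A
        t = x∈A , λ y y∈A cy → decidable-stable (y Fin.≟ x) (λ y≢x → ¬second (y , y∈A , cy , y≢x))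
        -- A heavy point of `B` is not `x`, since `A` misses `H`; at any other point it would
        -- exclude the tangent `A` at `x`.
        none : ∀ {y} → y ∈ₛ B → ¬ Heavy y
        none {y} y∈B hy with y Fin.≟ x
        ... | yes refl = ¬H (H-meets B∈ x∈B hy x∈A)
        ... | no  y≢x  = tangents-exclusive B∈ y∈B x∈B y≢x (≤-trans (m≤m+n 4 9) hy) A∈ t
      ... | yes (y , y∈A , cy , y≢x) with find cy
      ... | C , C∈ , y∈C with B ≟ₛ C
      -- Two common points force `A` to be the member `B` itself.
      ... | yes refl with pair 𝓟 y≢x A∈ (ppc-blocks ppc B∈) y∈A x∈A y∈C x∈B
      ...   | refl = inj₁ (lose B∈ (light-pattern B∈ (λ z∈B hz → ¬H (H-meets B∈ z∈B hz z∈B)) , inj₁ refl))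
      classify {A} A∈ ¬H | x , x∈A , cx | B , B∈ , x∈B | yes (y , y∈A , cy , y≢x) | C , C∈ , y∈C | no B≢C
        with ∈-crossPairs lights B∈ C∈ B≢C (lights⁺ x∈B (λ hx → ¬H (H-meets B∈ x∈B hx x∈A)))
                                           (lights⁺ y∈C (λ hy → ¬H (H-meets C∈ y∈C hy y∈A)))
      ... | inj₁ i = inj₂ (A∈ , _ , i , y≢x ∘ sym , x∈A , y∈A)
      ... | inj₂ i = inj₂ (A∈ , _ , i , y≢x , y∈A , x∈A)

      -- Totals over the members of `P`

      lightnesses : List (Subset v) → ℕ
      lightnesses Q = sum (map lightness Q)

      -- A member has 3 light points, or 4 if its lightness is 1, whence 16 = 9 + 7 in the sum of
      -- squares.
      record Totals (Q : List (Subset v)) : Set where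
        field
          heavy-total  : length (concat (map heavies Q)) + lightnesses Q ≡ length Q
          light-total  : length (concat (map lights Q)) ≡ 3 * length Q + lightnesses Q
          square-total : sum (map (λ T → length T * length T) (map lights Q)) ≡ 9 * length Q + 7 * lightnesses Q
          extra-total  : sum (map (λ B → 13 * lightness B) Q) ≡ 13 * lightnesses Q

      totals : ∀ Q → All (λ B → HeavyPattern B ⊎ LightPattern B) Q → Totals Q
      totals [] [] = record { heavy-total = refl ; light-total = refl ; square-total = refl ; extra-total = refl }
      totals (B ∷ Q) (p ∷ ps) = record
        { heavy-total  = trans (cong (_+ lightnesses (B ∷ Q)) (length-++ (heavies B)))
            (trans (shuffle (length (heavies B)) _ (lightness B) _) (cong₂ _+_ (h-eq p) heavy-total))
        ; light-total  = trans (length-++ (lights B)) (trans (cong₂ _+_ (l-eq p) light-total)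
            (regroup₁ 3 (length Q) (lightness B) _))
        ; square-total = trans (cong₂ _+_ (sq-eq p) square-total) (regroup 9 7 (length Q) (lightness B) _)
        ; extra-total  = trans (cong (13 * lightness B +_) extra-total) (sym (*-distribˡ-+ 13 (lightness B) _))
        }
        where
        open Totals (totals Q ps)
        h-eq : HeavyPattern B ⊎ LightPattern B → length (heavies B) + lightness B ≡ 1
        h-eq (inj₁ (h , l)) rewrite h | l = refl
        h-eq (inj₂ (h , l)) rewrite h | l = refl
        l-eq : HeavyPattern B ⊎ LightPattern B → length (lights B) ≡ 3 + lightness B
        l-eq (inj₁ (h , l)) rewrite l = refl
        l-eq (inj₂ (h , l)) rewrite l = refl
        sq-eq : HeavyPattern B ⊎ LightPattern B → length (lights B) * length (lights B) ≡ 9 + 7 * lightness B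
        sq-eq (inj₁ (h , l)) rewrite l = refl
        sq-eq (inj₂ (h , l)) rewrite l = refl
        shuffle : ∀ a b c d → (a + b) + (c + d) ≡ (a + c) + (b + d)
        shuffle = solve-∀
        regroup : ∀ a b n l m → (a + b * l) + (a * n + b * m) ≡ a * suc n + b * (l + m)
        regroup = solve-∀
        regroup₁ : ∀ a n l m → (a + l) + (a * n + m) ≡ a * suc n + (l + m)
        regroup₁ = solve-∀

      private
        h M g : ℕ
        h = length H
        M = lightnesses P
        g = length K

      pairs-total : 2 * g + (9 * length P + 7 * M) ≡ (3 * length P + M) * (3 * length P + M)
      pairs-total = subst (λ t → 2 * g + t ≡ (3 * length P + M) * (3 * length P + M)) square-total
        (trans (length-crossPairs (map lights P)) (cong₂ _*_ light-total light-total))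
        where open Totals (totals P (All.tabulate pattern?))

      -- Here every member has a heavy point. If `A` missed `H`, all of these would lie off `A`,
      -- contrary to `heavy-met`.
      all-meet-H : M ≡ 0 → ∀ {A} → Block A → Any (_∈ₛ A) H
      all-meet-H M≡0 {A} A∈ with Any.any? (_∈? A) H
      ... | yes i = i
      ... | no ¬i = ⊥-elim (heavy-met A∈ heavy)
        where
        lightness≡0 : ∀ {B Q} → lightnesses Q ≡ 0 → B ∈ Q → lightness B ≡ 0
        lightness≡0 {Q = C ∷ _} eq (here refl) = m+n≡0⇒m≡0 (lightness C) eq
        lightness≡0 {Q = C ∷ _} eq (there i)   = lightness≡0 (m+n≡0⇒n≡0 (lightness C) eq) i
        heavy : ∀ {B} → B ∈ P → ∃ λ x → x ∈ₛ B × Heavy x × x ∉ₛ A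
        heavy {B} B∈ with pattern? B∈ | lightness≡0 M≡0 B∈
        ... | inj₂ (_ , l≡4) | l≡0 rewrite l≡4 = contradiction l≡0 λ ()
        ... | inj₁ (h≡1 , _) | _ with heavies B in eq | h≡1
        ... | x ∷ [] | _ = let x∈B , hx = heavies⁻ (subst (x ∈_) (sym eq) (here refl))
                           in x , x∈B , hx , λ x∈A → ¬i (H-meets B∈ x∈B hx x∈A)

      numBlocks-≤ : let ρ = length P in 27 * (ρ * ρ) + 60 ≤ 2 * v + 3 * ρ →
        6 * numBlocks 𝓟 + ρ * suc ρ ≤ 2 * (ρ * v)
      numBlocks-≤ v-large with meeting-bound H H-unique | M ≟ 0
      -- With a heavy point on every member, `h` equals the size of `P` and `n≤` is already the
      -- claim.
      ... | n , meeting , n≤ | yes M≡0 = ≤-trans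
          (+-mono-≤ (*-monoʳ-≤ 6 b≤n) (≤-reflexive (cong₂ _*_ (sym h≡ρ) (cong suc (sym h≡ρ)))))
          (≤-trans n≤ (≤-reflexive (cong (λ r → 2 * (r * v)) h≡ρ)))
        where
        h≡ρ : h ≡ length P
        h≡ρ = trans (sym (trans (cong (h +_) M≡0) (+-identityʳ h))) heavy-total
          where open Totals (totals P (All.tabulate pattern?))
        b≤n : numBlocks 𝓟 ≤ n
        b≤n = meeting (blocks 𝓟) (unique 𝓟) (All.tabulate (λ A∈ → A∈ , all-meet-H M≡0 A∈))
      ... | n , meeting , n≤ | no M≢0 = blocks-arithmetic {n = n} {g = g} h M M≢0 heavy-total b≤ n≤ pairs-total v-large
        where
        open Totals (totals P (All.tabulate pattern?))
        cover : ∀ {A} → Block A → (Block A × Any (_∈ₛ A) H) ⊎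
          (Any (λ B → Extra B A) P ⊎ (Block A × (∃ λ k → k ∈ K × Joined A k)))
        cover {A} A∈ with Any.any? (_∈? A) H
        ... | yes i = inj₁ (A∈ , i)
        ... | no ¬i = inj₂ (classify A∈ ¬i)
        b≤ : numBlocks 𝓟 ≤ n + (13 * M + g)
        b≤ = subst (λ e → numBlocks 𝓟 ≤ n + (e + g)) extra-total
          (atMost-⊎ cover meeting
            (atMost-⊎ (λ e → e) (atMost-⋃ (λ B → 13 * lightness B) P extra-bound) joined-bound)
            (blocks 𝓟) (unique 𝓟) (All.tabulate (λ i → i)))

open BlockCount using (numBlocks-≤)

open import Data.Integer as ℤ using (+_)
open import Data.Product using (_,_)
import Data.Integer.Properties as ℤ
import Data.Integer.Tactic.RingSolver as ℤ
import Data.Nat.Properties as ℕ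
open import Data.Rational.Unnormalised using (_/_; _-_; _≤_; _≥_; *≤*)
open import Relation.Binary.PropositionalEquality using (_≡_; refl; sym; trans; cong; cong₂; subst₂)

-- Passage between natural numbers and fractions

-- Inequality of unnormalised rationals is cross-multiplied inequality of integers. Adding `3 * ρ`
-- to both sides removes the negative term.
≥-cleared : ∀ ρ v → + v / 1 ≥ (+ 27 ℤ.* (+ ρ) ℤ.^ 2 ℤ.- + 3 ℤ.* + ρ ℤ.+ + 60) / 2 →
  27 ℕ.* (ρ ℕ.* ρ) ℕ.+ 60 ℕ.≤ 2 ℕ.* v ℕ.+ 3 ℕ.* ρ
≥-cleared ρ v (*≤* le) = ℤ.drop‿+≤+ (subst₂ ℤ._≤_ left right (ℤ.+-monoˡ-≤ (+ 3 ℤ.* + ρ) le))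
  where
  -- The product `x * (x * + 1)` is the unfolded square.
  clearˡ : ∀ x → (+ 27 ℤ.* (x ℤ.* (x ℤ.* + 1)) ℤ.- + 3 ℤ.* x ℤ.+ + 60) ℤ.* + 1 ℤ.+ + 3 ℤ.* x ≡
    + 27 ℤ.* (x ℤ.* x) ℤ.+ + 60
  clearˡ = ℤ.solve-∀
  left : (+ 27 ℤ.* (+ ρ) ℤ.^ 2 ℤ.- + 3 ℤ.* + ρ ℤ.+ + 60) ℤ.* + 1 ℤ.+ + 3 ℤ.* + ρ ≡
    + (27 ℕ.* (ρ ℕ.* ρ) ℕ.+ 60)
  left = trans (clearˡ (+ ρ)) (cong (ℤ._+ + 60)
    (trans (cong (+ 27 ℤ.*_) (sym (ℤ.pos-* ρ ρ))) (sym (ℤ.pos-* 27 (ρ ℕ.* ρ)))))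
  right : + v ℤ.* + 2 ℤ.+ + 3 ℤ.* + ρ ≡ + (2 ℕ.* v ℕ.+ 3 ℕ.* ρ)
  right = cong₂ ℤ._+_ (trans (sym (ℤ.pos-* v 2)) (cong +_ (ℕ.*-comm v 2))) (sym (ℤ.pos-* 3 ρ))

-- The unnormalised difference has denominator 18, so the integer inequality is three times the
-- hypothesis with `3 * s` subtracted from both sides.
≤-divided : ∀ b ρ v → 6 ℕ.* b ℕ.+ ρ ℕ.* ℕ.suc ρ ℕ.≤ 2 ℕ.* (ρ ℕ.* v) →
  + b / 1 ≤ + (ρ ℕ.* v) / 3 - + (ρ ℕ.* (ρ ℕ.+ 1)) / 6
≤-divided b ρ v le = *≤* (subst₂ ℤ._≤_ left right
  (ℤ.+-monoˡ-≤ (ℤ.- s ℤ.* + 3) (ℤ.*-monoˡ-≤-nonNeg (+ 3) (ℤ.+≤+ le))))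
  where
  s : ℤ.ℤ
  s = + (ρ ℕ.* (ρ ℕ.+ 1))
  cancel : ∀ b s → + 3 ℤ.* (+ 6 ℤ.* b ℤ.+ s) ℤ.+ ℤ.- s ℤ.* + 3 ≡ b ℤ.* + 18
  cancel = ℤ.solve-∀
  scale : ∀ w s → + 3 ℤ.* (+ 2 ℤ.* w) ℤ.+ ℤ.- s ℤ.* + 3 ≡ (w ℤ.* + 6 ℤ.+ ℤ.- s ℤ.* + 3) ℤ.* + 1
  scale = ℤ.solve-∀
  left : + 3 ℤ.* + (6 ℕ.* b ℕ.+ ρ ℕ.* ℕ.suc ρ) ℤ.+ ℤ.- s ℤ.* + 3 ≡ + b ℤ.* + 18
  left = trans (cong (λ t → + 3 ℤ.* t ℤ.+ ℤ.- s ℤ.* + 3)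
    (cong₂ ℤ._+_ (ℤ.pos-* 6 b) (cong (λ r → + (ρ ℕ.* r)) (ℕ.+-comm 1 ρ)))) (cancel (+ b) s)
  right : + 3 ℤ.* + (2 ℕ.* (ρ ℕ.* v)) ℤ.+ ℤ.- s ℤ.* + 3 ≡ (+ (ρ ℕ.* v) ℤ.* + 6 ℤ.+ ℤ.- s ℤ.* + 3) ℤ.* + 1
  right = trans (cong (λ t → + 3 ℤ.* t ℤ.+ ℤ.- s ℤ.* + 3) (ℤ.pos-* 2 (ρ ℕ.* v))) (scale (+ (ρ ℕ.* v)) s)

theorem3p22 : ∀ (ρ v : ℕ) → 1 ℕ.≤ ρ →
    + v / 1 ≥ (+ 27 ℤ.* (+ ρ) ℤ.^ 2 ℤ.- + 3 ℤ.* + ρ ℤ.+ + 60) / 2 →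
    (𝓟 : Packing v 4) → MaxPPCSize 𝓟 ρ →
    + numBlocks 𝓟 / 1 ≤ + (ρ ℕ.* v) / 3 - + (ρ ℕ.* (ρ ℕ.+ 1)) / 6
theorem3p22 ρ v _ v-large 𝓟 ((P , ppc , refl) , max) =
  ≤-divided (numBlocks 𝓟) ρ v (numBlocks-≤ 𝓟 ppc max (≥-cleared ρ v v-large))
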